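{- There is an absolute constant $C$ such that for all $n\ge 2$ and $r\ge 2$, the Move-All-Equally algorithm is $2^{C\sqrt{\log n\cdot\log r}}$-competitive against the static optimum for $r$-uniform Online Min-Sum Set Cover on $n$ elements.
   Context: Let $U$ be a set of $n$ elements; a permutation $\pi$ of $U$ gives each element $e$ a position $\pi[e]\in\{1,\dots,n\}$, and $\pi(S)=\min_{e\in S}\pi[e]$. $d_{KT}(\pi,\sigma)$ is the number of pairs of elements ordered differently by $\pi,\sigma$. In $r$-uniform Online Min-Sum Set Cover, from an initial permutation $\pi_0$, request sets $S_1,\dots,S_m$ with $|S_t|=r$ arrive online; on arrival of $S_t$ an algorithm holding $\pi_{t-1}$ pays $\pi_{t-1}(S_t)$ and then moves to $\pi_t$ paying $d_{KT}(\pi_{t-1},\pi_t)$. The static optimum is $\mathrm{OPT}=\min_\pi\sum_t\pi(S_t)$. An algorithm is $c$-competitive if its cost is at most $c\cdot\mathrm{OPT}+\alpha$ for all initial permutations and sequences, with $\alpha$ independent of the sequence (possibly depending on $n,r$). Move-All-Equally: given current permutation $\pi$ and request $S$, let $k=\pi(S)$; the new permutation places each $e\in S$ at position $\pi[e]-(k-1)$ and the elements of $U\setminus S$ fill the remaining positions in their relative order in $\pi$. -}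

module Defs where

open import Data.Bool using (Bool; true; false; if_then_else_; not; _∧_; _xor_)
open import Data.Nat using (ℕ; zero; suc; _+_; _*_; _∸_; _^_; _≤_; _⊓_; _<ᵇ_; _≤ᵇ_)
open import Data.Nat.Logarithm using (⌊log₂_⌋)
open import Data.Fin using (Fin; toℕ)
open import Data.Fin.Properties using (_≟_)
open import Data.Maybe using (Maybe; just; nothing)
open import Data.List using (List; []; _∷_; _++_; length; allFin; replicate; map; filterᵇ; takeWhileᵇ; dropWhileᵇ; concatMap)
open import Data.Bool.ListAction using (any)
open import Data.Product using (_×_; _,_)
open import Relation.Nullary using (does)

-- Elements are Fin n.  A permutation π is represented as a list (the ordering
-- of the elements from position 1 to position n); validity is L ↭ allFin n.

_∈ᵇ_ : ∀ {n} → Fin n → List (Fin n) → Bool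
x ∈ᵇ S = any (λ y → does (x ≟ y)) S

pos : ∀ {n} → List (Fin n) → Fin n → ℕ
pos [] e = 0
pos (x ∷ xs) e = if does (x ≟ e) then 1 else suc (pos xs e)

-- π(S) = min_{e ∈ S} π[e]   (S nonempty in our use; all positions ≤ length L)
reqCost : ∀ {n} → List (Fin n) → List (Fin n) → ℕ
reqCost L S = foldrMin S
  where
  foldrMin : List _ → ℕ
  foldrMin [] = length L
  foldrMin (e ∷ es) = pos L e ⊓ foldrMin es

dKT : ∀ {n} → List (Fin n) → List (Fin n) → ℕ
dKT {n} L M = length (filterᵇ disagree pairs)
  where
  pairs : List (Fin n × Fin n)
  pairs = concatMap (λ a → map (λ b → a , b) (filterᵇ (λ b → toℕ a <ᵇ toℕ b) (allFin n))) (allFin n)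
  disagree : _ → Bool
  disagree (a , b) = (pos L a <ᵇ pos L b) xor (pos M a <ᵇ pos M b)

fill : {A : Set} → List (Maybe A) → List A → List A
fill [] ys = []
fill (just x ∷ p) ys = x ∷ fill p ys
fill (nothing ∷ p) [] = []
fill (nothing ∷ p) (y ∷ ys) = y ∷ fill p ys

-- Move-All-Equally.  prefix = the first k-1 elements (none in S), rest = the
-- elements from position k on.  Each e ∈ S moves from position π[e] to
-- π[e] - (k-1), i.e. to its index within rest; the elements of U \ S fill the
-- remaining positions in their relative order in π.
mae : ∀ {n} → List (Fin n) → List (Fin n) → List (Fin n)
mae L S = fill slots (prefix ++ filterᵇ (λ x → not (x ∈ᵇ S)) rest)
  where
  prefix = takeWhileᵇ (λ x → not (x ∈ᵇ S)) L
  rest   = dropWhileᵇ (λ x → not (x ∈ᵇ S)) L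
  slots = map (λ x → if x ∈ᵇ S then just x else nothing) rest
            ++ replicate (length prefix) nothing

maeCost : ∀ {n} → List (Fin n) → List (List (Fin n)) → ℕ
maeCost L [] = 0
maeCost L (S ∷ Ss) = reqCost L S + dKT L (mae L S) + maeCost (mae L S) Ss

staticCost : ∀ {n} → List (Fin n) → List (List (Fin n)) → ℕ
staticCost π [] = 0
staticCost π (S ∷ Ss) = reqCost π S + staticCost π Ss

csqrt : ℕ → ℕ
csqrt m = go 0 m
  where
  go : ℕ → ℕ → ℕ
  go k zero = k
  go k (suc f) = if m ≤ᵇ k * k then k else go (suc k) f

ratio : ℕ → ℕ → ℕ → ℕ
ratio C n r = 2 ^ (C * csqrt (⌊log₂ n ⌋ * ⌊log₂ r ⌋))

{-# OPTIONS --safe #-}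
module Submission where

-- Order the elements by the static permutation π and put the element at position j into
-- group ⌊log₂ j⌋ / s, where s = ⌈√(log n · log r)⌉, so that there are O(log n / s) groups
-- and group i consists of positions in [2^(i s), 2^((i+1) s)).  The potential is the sum of
-- the current positions, weighted by R^(K - i) in group i, with R > r.
--
-- Let a request be served by π through t in group i, and by the algorithm with p elements
-- in front of the request.  Then t moves forward by p.  The (1 + i) first groups have at most
-- 2^s π[t] elements, each of which moves back by at most r.  The remaining elements move back
-- by at most r p altogether, at a weight smaller by the factor R, so that the drop caused
-- by t pays for them and for the actual cost of at most 1 + p + r p.
-- What is left is at most (1 + 2^s R^K r) π[t] = 2^O(s) π[t].

open import Defs
open import Data.Bool using (Bool; true; false; if_then_else_; not; _xor_; T)
open import Data.Bool.Properties using (xor-same; not-injective; T-≡; T?)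
open import Data.Nat using (ℕ; zero; suc; _+_; _*_; _∸_; _^_; _≤_; _<_; _<ᵇ_; _≤ᵇ_; z≤n; s≤s; ⌊_/2⌋; NonZero; >-nonZero; >-nonZero⁻¹)
open import Data.Nat.Properties hiding (_≟_)
open import Data.Nat.DivMod using (_/_; _%_; m≡m%n+[m/n]*n; m%n<n; m/n*n≤m; /-monoˡ-≤)
open import Data.Nat.Logarithm using (⌊log₂_⌋; ⌊log₂⌋-mono-≤; ⌊log₂⌊n/2⌋⌋≡⌊log₂n⌋∸1; ⌊log₂[2^n]⌋≡n)
open import Data.Nat.Induction using (<-rec)
open import Data.Nat.ListAction using (sum)
open import Data.Nat.ListAction.Properties using (sum-↭; sum-++)
open import Data.Nat.Tactic.RingSolver using (solve-∀)
open import Data.Fin using (Fin; toℕ)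
open import Data.Fin.Properties using (_≟_)
open import Data.Maybe using (just; nothing)
open import Data.List using (List; []; _∷_; _++_; _∷ʳ_; length; allFin; map; filterᵇ; takeWhileᵇ; dropWhileᵇ; replicate; concatMap)
open import Data.List.Properties using (map-++; length-++; length-tabulate; ++-assoc; ++-identityʳ; takeWhile++dropWhile)
open import Data.List.Membership.Propositional using (_∈_)
open import Data.List.Membership.Propositional.Properties using (∈-allFin; ∈-++⁻)
open import Data.List.Relation.Unary.Any using (here; there)
open import Data.List.Relation.Unary.All as All using (All; []; _∷_)
import Data.List.Relation.Unary.All.Properties as All
open import Data.List.Relation.Unary.AllPairs using ([]; _∷_)
open import Data.List.Relation.Unary.Unique.Propositional using (Unique)
open import Data.List.Relation.Unary.Unique.Propositional.Properties using (allFin⁺)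
open import Data.List.Relation.Binary.Permutation.Propositional using (_↭_; ↭-refl; ↭-sym; ↭-trans; prep; swap; ↭⇒↭ₛ)
open import Data.List.Relation.Binary.Permutation.Propositional.Properties using (map⁺; ∈-resp-↭; ↭-length)
import Data.List.Relation.Binary.Permutation.Setoid.Properties as ↭ₛ
open import Data.Product using (_×_; _,_; proj₂; ∃-syntax)
open import Data.Sum using (_⊎_; inj₁; inj₂)
open import Function using (_∘_; Equivalence)
open import Relation.Nullary using (does; yes; no; contradiction)
open import Relation.Nullary.Decidable using (dec-true; dec-false)
open import Relation.Binary.PropositionalEquality using (_≡_; _≢_; refl; sym; trans; cong; cong₂; subst; setoid; module ≡-Reasoning)

private
  variable
    A B : Set
    n : ℕ

-- Indicators and finite sums.

𝟙 : Bool → ℕ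
𝟙 true  = 1
𝟙 false = 0

𝟙≤1 : ∀ b → 𝟙 b ≤ 1
𝟙≤1 true  = ≤-refl
𝟙≤1 false = z≤n

∑ : (A → ℕ) → List A → ℕ
∑ f xs = sum (map f xs)

∑-mono : {f g : A → ℕ} → (∀ x → f x ≤ g x) → ∀ xs → ∑ f xs ≤ ∑ g xs
∑-mono f≤g []       = z≤n
∑-mono f≤g (x ∷ xs) = +-mono-≤ (f≤g x) (∑-mono f≤g xs)

+-interchange : ∀ a b c d → (a + b) + (c + d) ≡ (a + c) + (b + d)
+-interchange = solve-∀

∑-+ : (f g : A → ℕ) → ∀ xs → ∑ (λ x → f x + g x) xs ≡ ∑ f xs + ∑ g xs
∑-+ f g []       = refl
∑-+ f g (x ∷ xs) rewrite ∑-+ f g xs = +-interchange (f x) (g x) (∑ f xs) (∑ g xs)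

∑-*ˡ : (c : ℕ) (f : A → ℕ) → ∀ xs → ∑ (λ x → c * f x) xs ≡ c * ∑ f xs
∑-*ˡ c f []       = sym (*-zeroʳ c)
∑-*ˡ c f (x ∷ xs) rewrite ∑-*ˡ c f xs = sym (*-distribˡ-+ c (f x) (∑ f xs))

∑-*ʳ : (c : ℕ) (f : A → ℕ) → ∀ xs → ∑ (λ x → f x * c) xs ≡ ∑ f xs * c
∑-*ʳ c f []       = refl
∑-*ʳ c f (x ∷ xs) rewrite ∑-*ʳ c f xs = sym (*-distribʳ-+ c (f x) (∑ f xs))

∑-term : (f : A → ℕ) {x : A} {xs : List A} → x ∈ xs → f x ≤ ∑ f xs
∑-term f (here refl)            = m≤m+n _ _
∑-term f (there {x = y} x∈xs) = ≤-trans (∑-term f x∈xs) (m≤n+m _ (f y))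

∑-≤-length : (f : A → ℕ) (c : ℕ) → (∀ x → f x ≤ c) → ∀ xs → ∑ f xs ≤ length xs * c
∑-≤-length f c f≤c []       = z≤n
∑-≤-length f c f≤c (x ∷ xs) = +-mono-≤ (f≤c x) (∑-≤-length f c f≤c xs)

∑-zero : {f : A → ℕ} → (∀ x → f x ≡ 0) → ∀ xs → ∑ f xs ≡ 0
∑-zero f≡0 []       = refl
∑-zero f≡0 (x ∷ xs) = cong₂ _+_ (f≡0 x) (∑-zero f≡0 xs)

∑-cong : {f g : A → ℕ} → (∀ x → f x ≡ g x) → ∀ xs → ∑ f xs ≡ ∑ g xs
∑-cong f≡g []       = refl
∑-cong f≡g (x ∷ xs) = cong₂ _+_ (f≡g x) (∑-cong f≡g xs)

∑-++ : (f : A → ℕ) → ∀ xs ys → ∑ f (xs ++ ys) ≡ ∑ f xs + ∑ f ys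
∑-++ f xs ys = trans (cong sum (map-++ f xs ys)) (sum-++ (map f xs) (map f ys))

length-filterᵇ : (p : A → Bool) → ∀ xs → length (filterᵇ p xs) ≡ ∑ (𝟙 ∘ p) xs
length-filterᵇ p []       = refl
length-filterᵇ p (x ∷ xs) with p x
... | true  = cong suc (length-filterᵇ p xs)
... | false = length-filterᵇ p xs

∑-map-filterᵇ : (f : B → ℕ) (h : A → B) (q : A → Bool) → ∀ xs →
                ∑ f (map h (filterᵇ q xs)) ≡ ∑ (λ x → 𝟙 (q x) * f (h x)) xs
∑-map-filterᵇ f h q []       = refl
∑-map-filterᵇ f h q (x ∷ xs) with q x
... | true  = cong₂ _+_ (sym (*-identityˡ _)) (∑-map-filterᵇ f h q xs)
... | false = ∑-map-filterᵇ f h q xs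

∑-concatMap : (f : B → ℕ) (h : A → List B) → ∀ xs → ∑ f (concatMap h xs) ≡ ∑ (λ x → ∑ f (h x)) xs
∑-concatMap f h []       = refl
∑-concatMap f h (x ∷ xs) =
  trans (∑-++ f (h x) (concatMap h xs)) (cong (∑ f (h x) +_) (∑-concatMap f h xs))

-- Counting in duplicate-free lists.

∑-absent : {u : Fin n} {xs : List (Fin n)} → All (λ x → u ≢ x) xs → ∑ (λ x → 𝟙 (does (u ≟ x))) xs ≡ 0
∑-absent []                   = refl
∑-absent {u = u} (u≢x ∷ u∉xs) rewrite dec-false (u ≟ _) u≢x = ∑-absent u∉xs

∑-unique : (u : Fin n) {xs : List (Fin n)} → Unique xs → ∑ (λ x → 𝟙 (does (u ≟ x))) xs ≤ 1
∑-unique u []              = z≤n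
∑-unique u {x ∷ _} (x∉xs ∷ uxs) with u ≟ x
... | yes refl rewrite ∑-absent x∉xs = ≤-refl
... | no  _    = ∑-unique u uxs

Unique-resp-↭ : {xs ys : List (Fin n)} → xs ↭ ys → Unique xs → Unique ys
Unique-resp-↭ p = ↭ₛ.Unique-resp-↭ (setoid _) (↭⇒↭ₛ p)

perm-unique : {L : List (Fin n)} → L ↭ allFin n → Unique L
perm-unique p = Unique-resp-↭ (↭-sym p) (allFin⁺ _)

perm-complete : {L : List (Fin n)} → L ↭ allFin n → ∀ e → e ∈ L
perm-complete p e = ∈-resp-↭ (↭-sym p) (∈-allFin e)

-- Induction on `S`: each entry of `S` accounts for at most one element of the duplicate-free `xs`.
∑-∈ᵇ : {xs : List (Fin n)} → Unique xs → ∀ S → ∑ (λ x → 𝟙 (x ∈ᵇ S)) xs ≤ length S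
∑-∈ᵇ {xs = xs} uxs [] = ≤-reflexive (∑-zero (λ _ → refl) xs)
∑-∈ᵇ {xs = xs} uxs (s ∷ S) = begin
  ∑ (λ x → 𝟙 (x ∈ᵇ (s ∷ S))) xs
    ≤⟨ ∑-mono split xs ⟩
  ∑ (λ x → 𝟙 (does (s ≟ x)) + 𝟙 (x ∈ᵇ S)) xs
    ≡⟨ ∑-+ (λ x → 𝟙 (does (s ≟ x))) (λ x → 𝟙 (x ∈ᵇ S)) xs ⟩
  ∑ (λ x → 𝟙 (does (s ≟ x))) xs + ∑ (λ x → 𝟙 (x ∈ᵇ S)) xs
    ≤⟨ +-mono-≤ (∑-unique s uxs) (∑-∈ᵇ uxs S) ⟩
  suc (length S) ∎
  where
  open ≤-Reasoning
  split : ∀ x → 𝟙 (x ∈ᵇ (s ∷ S)) ≤ 𝟙 (does (s ≟ x)) + 𝟙 (x ∈ᵇ S)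
  split x with x ≟ s
  ... | yes refl rewrite dec-true (s ≟ s) refl = m≤m+n 1 _
  ... | no  _    = m≤n+m _ _

∈⇒∈ᵇ : {x : Fin n} {S : List (Fin n)} → x ∈ S → (x ∈ᵇ S) ≡ true
∈⇒∈ᵇ {x = x} (here refl) rewrite dec-true (x ≟ x) refl = refl
∈⇒∈ᵇ {x = x} (there {x = y} x∈S) with x ≟ y
... | yes _ = refl
... | no  _ = ∈⇒∈ᵇ x∈S

-- Applied to a request, this gives `r ≤ n`, so that log r is at most log n.
unique-length : {S : List (Fin n)} → Unique S → length S ≤ n
unique-length {n} {S} uS = begin
  length S                          ≡⟨ count-all S ⟨
  ∑ (λ x → 𝟙 (x ∈ᵇ allFin n)) S     ≤⟨ ∑-∈ᵇ uS (allFin n) ⟩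
  length (allFin n)                 ≡⟨ length-tabulate {n = n} _ ⟩
  n                                 ∎
  where
  open ≤-Reasoning
  count-all : ∀ S → ∑ (λ x → 𝟙 (x ∈ᵇ allFin n)) S ≡ length S
  count-all []      = refl
  count-all (x ∷ S) rewrite ∈⇒∈ᵇ (∈-allFin x) = cong suc (count-all S)

-- Positions in a list.

pos-here : (x : Fin n) (xs : List (Fin n)) → pos (x ∷ xs) x ≡ 1
pos-here x xs rewrite dec-true (x ≟ x) refl = refl

pos-there : {x e : Fin n} (xs : List (Fin n)) → x ≢ e → pos (x ∷ xs) e ≡ suc (pos xs e)
pos-there {x = x} {e} xs x≢e rewrite dec-false (x ≟ e) x≢e = refl

pos-∷-≤ : (x : Fin n) (xs : List (Fin n)) (e : Fin n) → pos (x ∷ xs) e ≤ suc (pos xs e)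
pos-∷-≤ x xs e with x ≟ e
... | yes _ = s≤s z≤n
... | no  _ = ≤-refl

pos-∷-mono : (x : Fin n) (xs ys : List (Fin n)) (c : ℕ) (e : Fin n) →
             pos xs e ≤ pos ys e + c → pos (x ∷ xs) e ≤ pos (x ∷ ys) e + c
pos-∷-mono x xs ys c e h with x ≟ e
... | yes _ = s≤s z≤n
... | no  _ = s≤s h

pos≤length : (xs : List (Fin n)) (e : Fin n) → pos xs e ≤ length xs
pos≤length []       e = z≤n
pos≤length (x ∷ xs) e = ≤-trans (pos-∷-≤ x xs e) (s≤s (pos≤length xs e))

pos≥1 : {xs : List (Fin n)} {e : Fin n} → e ∈ xs → 1 ≤ pos xs e
pos≥1 {xs = x ∷ _} {e} _ with x ≟ e
... | yes _ = s≤s z≤n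
... | no  _ = s≤s z≤n

pos-skip : {q : List (Fin n)} {e : Fin n} → All (λ x → x ≢ e) q → ∀ xs →
           pos (q ++ xs) e ≡ length q + pos xs e
pos-skip []           xs = refl
pos-skip {q = _ ∷ q} (x≢e ∷ q≢e) xs = trans (pos-there (q ++ xs) x≢e) (cong suc (pos-skip q≢e xs))

pos-insert : (q : List (Fin n)) {x e : Fin n} → x ≢ e → ∀ xs → pos (q ++ xs) e ≤ pos (q ++ x ∷ xs) e
pos-insert [] x≢e xs rewrite pos-there xs x≢e = n≤1+n _
pos-insert (y ∷ q) {e = e} x≢e xs with y ≟ e
... | yes _ = ≤-refl
... | no  _ = s≤s (pos-insert q x≢e xs)

-- Removing the head uses up position 1 and lowers the position of every other entry by one, so the
-- bound `t` drops by one as well.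
count-pos≤ : {xs : List (Fin n)} → Unique xs → ∀ t → ∑ (λ e → 𝟙 (pos xs e ≤ᵇ t)) xs ≤ t
count-pos≤ {xs = []} [] t = z≤n
count-pos≤ {xs = x ∷ xs} (x∉xs ∷ uxs) t rewrite pos-here x xs = lemma t
  where
  tail : ∀ t {ys} → All (λ y → x ≢ y) ys →
         ∑ (λ e → 𝟙 (pos (x ∷ xs) e ≤ᵇ suc t)) ys ≡ ∑ (λ e → 𝟙 (pos xs e ≤ᵇ t)) ys
  tail t [] = refl
  tail t (_∷_ {y} x≢y x∉ys) rewrite pos-there xs x≢y =
    cong₂ _+_ (cong 𝟙 (shift (pos xs y))) (tail t x∉ys)
    where
    shift : ∀ m → (suc m ≤ᵇ suc t) ≡ (m ≤ᵇ t)
    shift zero    = refl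
    shift (suc m) = refl
  tail₀ : ∀ {ys} → All (λ y → x ≢ y) ys → ∑ (λ e → 𝟙 (pos (x ∷ xs) e ≤ᵇ 0)) ys ≡ 0
  tail₀ [] = refl
  tail₀ (x≢y ∷ x∉ys) rewrite pos-there xs x≢y = tail₀ x∉ys
  lemma : ∀ t → 𝟙 (1 ≤ᵇ t) + ∑ (λ e → 𝟙 (pos (x ∷ xs) e ≤ᵇ t)) xs ≤ t
  lemma zero rewrite tail₀ x∉xs = z≤n
  lemma (suc t) rewrite tail t x∉xs = s≤s (count-pos≤ uxs t)

-- The request cost as a minimum of positions.

reqCost-≤-pos : (L : List (Fin n)) {x : Fin n} (S : List (Fin n)) → (x ∈ᵇ S) ≡ true → reqCost L S ≤ pos L x
reqCost-≤-pos L {x} (s ∷ S) x∈S with x ≟ s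
... | yes refl = m⊓n≤m _ _
... | no  _    = ≤-trans (m⊓n≤n (pos L s) _) (reqCost-≤-pos L S x∈S)

reqCost-∷ : (x : Fin n) (xs S : List (Fin n)) → reqCost (x ∷ xs) S ≤ suc (reqCost xs S)
reqCost-∷ x xs []      = ≤-refl
reqCost-∷ x xs (s ∷ S) = ⊓-mono-≤ (pos-∷-≤ x xs s) (reqCost-∷ x xs S)

reqCost-attained : (L : List (Fin n)) (s : Fin n) (S : List (Fin n)) →
                   ∃[ t ] (t ∈ᵇ (s ∷ S)) ≡ true × pos L t ≤ reqCost L (s ∷ S)
-- `reqCost` closes its minimum with the default `length L`, which no position exceeds.
reqCost-attained L s [] = s , ∈⇒∈ᵇ {S = s ∷ []} (here refl) , ⊓-glb ≤-refl (pos≤length L s)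
reqCost-attained L s (s′ ∷ S) with reqCost-attained L s′ S
... | t , t∈S , t≤ with ≤-total (pos L s) (reqCost L (s′ ∷ S))
... | inj₁ s≤ = s , ∈⇒∈ᵇ {S = s ∷ s′ ∷ S} (here refl) , ⊓-glb ≤-refl s≤
... | inj₂ ≥s = t , weaken , ⊓-glb (≤-trans t≤ ≥s) t≤
  where
  weaken : (t ∈ᵇ (s ∷ s′ ∷ S)) ≡ true
  weaken with t ≟ s
  ... | yes _ = refl
  ... | no  _ = t∈S

-- The first requested element stands right behind the passed prefix. If there is none, the prefix
-- is all of `L`, and its length bounds every position.
reqCost-≤-prefix : (L S : List (Fin n)) → reqCost L S ≤ suc (length (takeWhileᵇ (λ x → not (x ∈ᵇ S)) L))
reqCost-≤-prefix []       S = ≤-trans (reqCost-[] S) z≤n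
  where
  reqCost-[] : (S : List (Fin n)) → reqCost [] S ≤ 0
  reqCost-[] []      = z≤n
  reqCost-[] (s ∷ S) = z≤n
reqCost-≤-prefix (x ∷ xs) S with x ∈ᵇ S in x∈S
... | true  = ≤-trans (reqCost-≤-pos (x ∷ xs) S x∈S) (≤-reflexive (pos-here x xs))
... | false = ≤-trans (reqCost-∷ x xs S) (s≤s (reqCost-≤-prefix xs S))

-- Adjacent transpositions and backward movement.

infix 4 _⟿[_]_

-- The index counts adjacent transpositions, which `cons` allows at any depth. One derivation for
-- Move-All-Equally then bounds both its movement cost and the backward movement seen by the
-- potential.
data _⟿[_]_ {A : Set} : List A → ℕ → List A → Set where
  stay  : ∀ {L} → L ⟿[ 0 ] L
  flip  : ∀ x y L → x ∷ y ∷ L ⟿[ 1 ] y ∷ x ∷ L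
  cons  : ∀ x {L M m} → L ⟿[ m ] M → x ∷ L ⟿[ m ] x ∷ M
  _then_ : ∀ {L M N m k} → L ⟿[ m ] M → M ⟿[ k ] N → L ⟿[ m + k ] N

⟿-↭ : {L M : List A} {m : ℕ} → L ⟿[ m ] M → L ↭ M
⟿-↭ stay         = ↭-refl
⟿-↭ (flip x y L) = swap x y ↭-refl
⟿-↭ (cons x s)   = prep x (⟿-↭ s)
⟿-↭ (s then s′)  = ↭-trans (⟿-↭ s) (⟿-↭ s′)

-- One hypothesis per constructor; `F` will be `drift` and `inversions`.
⟿-bound : (F : List A → List A → ℕ) →
          (∀ L → F L L ≤ 0) →
          (∀ x y L → F (x ∷ y ∷ L) (y ∷ x ∷ L) ≤ 1) →
          (∀ x L M → F (x ∷ L) (x ∷ M) ≤ F L M) →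
          (∀ L M N → F L N ≤ F L M + F M N) →
          ∀ {L M m} → L ⟿[ m ] M → F L M ≤ m
⟿-bound F F₀ F₁ Fᶜ F⁺ = go
  where
  go : ∀ {L M m} → L ⟿[ m ] M → F L M ≤ m
  go stay         = F₀ _
  go (flip x y L) = F₁ x y L
  go (cons x s)   = ≤-trans (Fᶜ x _ _) (go s)
  go (s then s′)  = ≤-trans (F⁺ _ _ _) (+-mono-≤ (go s) (go s′))

-- Truncated subtraction ignores elements that move forward, so this is the total backward movement.
drift : List (Fin n) → List (Fin n) → ℕ
drift {n} L M = ∑ (λ e → pos M e ∸ pos L e) (allFin n)

drift-⟿ : {L M : List (Fin n)} {m : ℕ} → L ⟿[ m ] M → drift L M ≤ m
drift-⟿ {n} = ⟿-bound drift d₀ d₁ dᶜ d⁺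
  where
  d₀ : ∀ L → drift L L ≤ 0
  d₀ L = ≤-reflexive (∑-zero (λ e → n∸n≡0 (pos L e)) (allFin n))
  d₁ : ∀ x y L → drift (x ∷ y ∷ L) (y ∷ x ∷ L) ≤ 1
  d₁ x y L = ≤-trans (∑-mono only-x (allFin n)) (∑-unique x (allFin⁺ n))
    where
    -- In a flip only `x` can move back, and by one place.
    only-x : ∀ e → pos (y ∷ x ∷ L) e ∸ pos (x ∷ y ∷ L) e ≤ 𝟙 (does (x ≟ e))
    only-x e with x ≟ e | y ≟ e
    ... | yes _ | yes _ = z≤n
    ... | yes _ | no  _ = ≤-refl
    ... | no  _ | yes _ = z≤n
    ... | no  _ | no  _ = ≤-reflexive (n∸n≡0 (pos L e))
  dᶜ : ∀ x L M → drift (x ∷ L) (x ∷ M) ≤ drift L M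
  dᶜ x L M = ∑-mono shorter (allFin n)
    where
    shorter : ∀ e → pos (x ∷ M) e ∸ pos (x ∷ L) e ≤ pos M e ∸ pos L e
    shorter e with x ≟ e
    ... | yes _ = z≤n
    ... | no  _ = ≤-refl
  d⁺ : ∀ L M N → drift L N ≤ drift L M + drift M N
  d⁺ L M N = ≤-trans (∑-mono (λ e → triangle (pos L e) (pos M e) (pos N e)) (allFin n))
                     (≤-reflexive (∑-+ (λ e → pos M e ∸ pos L e) (λ e → pos N e ∸ pos M e) (allFin n)))
    where
    triangle : ∀ a b c → c ∸ a ≤ (b ∸ a) + (c ∸ b)
    triangle a b c = m≤n+o⇒m∸n≤o c a (begin
      c                          ≤⟨ m≤n+m∸n c b ⟩
      b + (c ∸ b)                ≤⟨ +-monoˡ-≤ (c ∸ b) (m≤n+m∸n b a) ⟩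
      a + (b ∸ a) + (c ∸ b)      ≡⟨ +-assoc a _ _ ⟩
      a + ((b ∸ a) + (c ∸ b))    ∎)
      where open ≤-Reasoning

-- The Kendall tau distance as a count of inversions.

-- The 0-based position.  It places absent elements strictly behind all members,
-- which pos does not: pos L e = length L both for an absent e and for the last element.
index : List (Fin n) → Fin n → ℕ
index []       e = 0
index (x ∷ xs) e = if does (x ≟ e) then 0 else suc (index xs e)

pos≡1+index : {L : List (Fin n)} {e : Fin n} → e ∈ L → pos L e ≡ suc (index L e)
pos≡1+index {L = x ∷ L} (here refl) rewrite dec-true (x ≟ x) refl = refl
pos≡1+index {L = x ∷ L} {e} (there e∈L) with x ≟ e
... | yes _ = refl
... | no  _ = cong suc (pos≡1+index e∈L)

disagree : List (Fin n) → List (Fin n) → Fin n → Fin n → Bool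
disagree L M a b = (index L a <ᵇ index L b) xor (index M a <ᵇ index M b)

disagreement : List (Fin n) → List (Fin n) → Fin n → Fin n → ℕ
disagreement L M a b = 𝟙 (toℕ a <ᵇ toℕ b) * 𝟙 (disagree L M a b)

inversions : List (Fin n) → List (Fin n) → ℕ
inversions {n} L M = ∑ (λ a → ∑ (disagreement L M a) (allFin n)) (allFin n)

-- Where every element occurs, `pos` is `index` shifted by one, so all comparisons agree. The rest
-- turns the flat list of pairs into a double sum.
dKT≡inversions : {L M : List (Fin n)} → (∀ e → e ∈ L) → (∀ e → e ∈ M) → dKT L M ≡ inversions L M
dKT≡inversions {n} {L} {M} all-L all-M = begin
  dKT L M
    -- The underscores stand for the predicate local to `dKT`.
    ≡⟨ length-filterᵇ _ (concatMap row (allFin n)) ⟩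
  ∑ _ (concatMap row (allFin n))
    ≡⟨ ∑-concatMap _ row (allFin n) ⟩
  ∑ (λ a → ∑ _ (row a)) (allFin n)
    ≡⟨ ∑-cong (λ a → trans (∑-map-filterᵇ _ (a ,_) (λ b → toℕ a <ᵇ toℕ b) (allFin n))
                           (∑-cong (pair a) (allFin n))) (allFin n) ⟩
  inversions L M ∎
  where
  open ≡-Reasoning
  row : Fin n → List (Fin n × Fin n)
  row a = map (a ,_) (filterᵇ (λ b → toℕ a <ᵇ toℕ b) (allFin n))
  pair : ∀ a b → 𝟙 (toℕ a <ᵇ toℕ b) * 𝟙 ((pos L a <ᵇ pos L b) xor (pos M a <ᵇ pos M b)) ≡ disagreement L M a b
  pair a b rewrite pos≡1+index (all-L a) | pos≡1+index (all-L b)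
                 | pos≡1+index (all-M a) | pos≡1+index (all-M b) = refl

<ᵇ-asym : ∀ a b → (a <ᵇ b) ≡ true → (b <ᵇ a) ≡ false
<ᵇ-asym zero    (suc b) _   = refl
<ᵇ-asym (suc a) (suc b) a<b = <ᵇ-asym a b a<b

-- Every element other than `x` and `y` keeps its index, which is at least 2, so only the order
-- between `x` and `y` can change.
disagree-flip : (x y : Fin n) (L : List (Fin n)) (a b : Fin n) →
                disagree (x ∷ y ∷ L) (y ∷ x ∷ L) a b ≡ true →
                (x ≡ a × y ≡ b) ⊎ (y ≡ a × x ≡ b)
disagree-flip x y L a b dis with x ≟ a | y ≟ a | x ≟ b | y ≟ b
... | yes x≡a | no _    | no _    | yes y≡b = inj₁ (x≡a , y≡b)
... | no _    | yes y≡a | yes x≡b | no _    = inj₂ (y≡a , x≡b)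
... | no _    | no _    | no _    | no _    = contradiction (trans (sym dis) (xor-same (index L a <ᵇ index L b))) λ ()
... | yes x≡a | yes y≡a | yes x≡b | yes y≡b = inj₁ (x≡a , y≡b)
... | yes x≡a | yes y≡a | no _    | yes y≡b = inj₁ (x≡a , y≡b)
... | yes x≡a | yes y≡a | yes x≡b | no _    = inj₂ (y≡a , x≡b)
... | yes x≡a | no _    | yes x≡b | yes y≡b = inj₁ (x≡a , y≡b)
... | no _    | yes y≡a | yes x≡b | yes y≡b = inj₂ (y≡a , x≡b)
-- In the remaining cases both comparisons compute to the same Boolean, so `dis` is absurd.
disagree-flip x y L a b () | yes _ | yes _ | no _  | no _
disagree-flip x y L a b () | yes _ | no _  | yes _ | no _
disagree-flip x y L a b () | yes _ | no _  | no _  | no _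
disagree-flip x y L a b () | no _  | yes _ | no _  | yes _
disagree-flip x y L a b () | no _  | yes _ | no _  | no _
disagree-flip x y L a b () | no _  | no _  | yes _ | yes _
disagree-flip x y L a b () | no _  | no _  | yes _ | no _
disagree-flip x y L a b () | no _  | no _  | no _  | yes _

inversions-⟿ : {L M : List (Fin n)} {m : ℕ} → L ⟿[ m ] M → inversions L M ≤ m
inversions-⟿ {n} = ⟿-bound inversions i₀ i₁ iᶜ i⁺
  where
  i₀ : ∀ L → inversions L L ≤ 0
  i₀ L = ≤-reflexive (∑-zero (λ a → ∑-zero (none a) (allFin n)) (allFin n))
    where
    none : ∀ a b → disagreement L L a b ≡ 0
    none a b rewrite xor-same (index L a <ᵇ index L b) = *-zeroʳ (𝟙 (toℕ a <ᵇ toℕ b))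
  i₁ : ∀ x y L → inversions (x ∷ y ∷ L) (y ∷ x ∷ L) ≤ 1
  i₁ x y L = begin
    inversions (x ∷ y ∷ L) (y ∷ x ∷ L)
      ≤⟨ ∑-mono (λ a → ∑-mono (only-uv a) (allFin n)) (allFin n) ⟩
    ∑ (λ a → ∑ (λ b → 𝟙 (does (u ≟ a)) * 𝟙 (does (v ≟ b))) (allFin n)) (allFin n)
      ≡⟨ ∑-cong (λ a → ∑-*ˡ (𝟙 (does (u ≟ a))) (λ b → 𝟙 (does (v ≟ b))) (allFin n)) (allFin n) ⟩
    ∑ (λ a → 𝟙 (does (u ≟ a)) * ∑ (λ b → 𝟙 (does (v ≟ b))) (allFin n)) (allFin n)
      ≡⟨ ∑-*ʳ _ (λ a → 𝟙 (does (u ≟ a))) (allFin n) ⟩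
    ∑ (λ a → 𝟙 (does (u ≟ a))) (allFin n) * ∑ (λ b → 𝟙 (does (v ≟ b))) (allFin n)
      ≤⟨ *-mono-≤ (∑-unique u (allFin⁺ n)) (∑-unique v (allFin⁺ n)) ⟩
    1 ∎
    where
    open ≤-Reasoning
    -- `disagreement` counts a pair only with its smaller element first, so `x` and `y` have to be
    -- sorted.
    u = if toℕ x <ᵇ toℕ y then x else y
    v = if toℕ x <ᵇ toℕ y then y else x
    only-uv : ∀ a b → disagreement (x ∷ y ∷ L) (y ∷ x ∷ L) a b ≤ 𝟙 (does (u ≟ a)) * 𝟙 (does (v ≟ b))
    only-uv a b with toℕ a <ᵇ toℕ b in a<b
    ... | false = z≤n
    ... | true with disagree (x ∷ y ∷ L) (y ∷ x ∷ L) a b in dis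
    ...   | false = z≤n
    ...   | true with disagree-flip x y L a b dis
    ...     | inj₁ (refl , refl) rewrite a<b | dec-true (a ≟ a) refl | dec-true (b ≟ b) refl = ≤-refl
    ...     | inj₂ (refl , refl) rewrite <ᵇ-asym (toℕ a) (toℕ b) a<b
                                       | dec-true (a ≟ a) refl | dec-true (b ≟ b) refl = ≤-refl
  iᶜ : ∀ x L M → inversions (x ∷ L) (x ∷ M) ≤ inversions L M
  iᶜ x L M = ∑-mono (λ a → ∑-mono (λ b → *-monoʳ-≤ (𝟙 (toℕ a <ᵇ toℕ b)) (fewer a b)) (allFin n)) (allFin n)
    where
    fewer : ∀ a b → 𝟙 (disagree (x ∷ L) (x ∷ M) a b) ≤ 𝟙 (disagree L M a b)
    fewer a b with x ≟ a | x ≟ b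
    ... | yes _ | yes _ = z≤n
    ... | yes _ | no  _ = z≤n
    ... | no  _ | yes _ = z≤n
    ... | no  _ | no  _ = ≤-refl
  i⁺ : ∀ L M N → inversions L N ≤ inversions L M + inversions M N
  i⁺ L M N = begin
    inversions L N
      ≤⟨ ∑-mono (λ a → ∑-mono (triangle a) (allFin n)) (allFin n) ⟩
    ∑ (λ a → ∑ (λ b → disagreement L M a b + disagreement M N a b) (allFin n)) (allFin n)
      ≡⟨ ∑-cong (λ a → ∑-+ (disagreement L M a) (disagreement M N a) (allFin n)) (allFin n) ⟩
    ∑ (λ a → ∑ (disagreement L M a) (allFin n) + ∑ (disagreement M N a) (allFin n)) (allFin n)
      ≡⟨ ∑-+ (λ a → ∑ (disagreement L M a) (allFin n)) (λ a → ∑ (disagreement M N a) (allFin n)) (allFin n) ⟩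
    inversions L M + inversions M N ∎
    where
    open ≤-Reasoning
    𝟙-xor : ∀ p q r → 𝟙 (p xor r) ≤ 𝟙 (p xor q) + 𝟙 (q xor r)
    𝟙-xor true  true  r     = ≤-refl
    𝟙-xor true  false r     = ≤-trans (𝟙≤1 (not r)) (m≤m+n 1 _)
    𝟙-xor false true  r     = ≤-trans (𝟙≤1 r) (m≤m+n 1 _)
    𝟙-xor false false r     = ≤-refl
    triangle : ∀ a b → disagreement L N a b ≤ disagreement L M a b + disagreement M N a b
    triangle a b = ≤-trans
      (*-monoʳ-≤ (𝟙 (toℕ a <ᵇ toℕ b))
        (𝟙-xor (index L a <ᵇ index L b) (index M a <ᵇ index M b) (index N a <ᵇ index N b)))
      (≤-reflexive (*-distribˡ-+ (𝟙 (toℕ a <ᵇ toℕ b)) _ _))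

-- Move-All-Equally with a queue.

-- Move-All-Equally as a single pass over the list from the first requested
-- element on: q is the queue of passed-over elements that wait for a slot.
run : (A → Bool) → List A → List A → List A
run p []      xs       = xs
run p (h ∷ q) []       = h ∷ q
run p (h ∷ q) (x ∷ xs) = if p x then x ∷ run p (h ∷ q) xs else h ∷ run p (q ∷ʳ x) xs

-- The trailing empty slots are as many as the queued elements. An unrequested `x` yields its slot
-- to the head of the queue and joins the back, which preserves this.
fill-run : (p : A → Bool) (q xs : List A) →
           fill (map (λ x → if p x then just x else nothing) xs ++ replicate (length q) nothing)
                (q ++ filterᵇ (not ∘ p) xs) ≡ run p q xs
fill-run p []      []       = refl
fill-run p []      (x ∷ xs) with p x
... | true  = cong (x ∷_) (fill-run p [] xs)
... | false = cong (x ∷_) (fill-run p [] xs)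
fill-run p (h ∷ q) []       = cong (h ∷_) (fill-run-[] q)
  where
  fill-run-[] : ∀ q → fill (replicate (length q) nothing) (q ++ []) ≡ q
  fill-run-[] []      = refl
  fill-run-[] (h ∷ q) = cong (h ∷_) (fill-run-[] q)
fill-run p (h ∷ q) (x ∷ xs) with p x
... | true  = cong (x ∷_) (fill-run p (h ∷ q) xs)
... | false = cong (h ∷_) (begin
  fill (slots ++ replicate (suc (length q)) nothing) (q ++ x ∷ others)
    ≡⟨ cong₂ (λ m ys → fill (slots ++ replicate m nothing) ys) (length-∷ʳ q) (++-assoc q (x ∷ []) others) ⟨
  fill (slots ++ replicate (length (q ∷ʳ x)) nothing) ((q ∷ʳ x) ++ others)
    ≡⟨ fill-run p (q ∷ʳ x) xs ⟩
  run p (q ∷ʳ x) xs ∎)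
  where
  open ≡-Reasoning
  slots  = map (λ x → if p x then just x else nothing) xs
  others = filterᵇ (not ∘ p) xs
  length-∷ʳ : ∀ q → length (q ∷ʳ x) ≡ suc (length q)
  length-∷ʳ q = trans (length-++ q) (+-comm (length q) 1)

⟿-front : (q : List A) (x : A) (xs : List A) → q ++ x ∷ xs ⟿[ length q ] x ∷ (q ++ xs)
⟿-front []      x xs = stay
⟿-front (h ∷ q) x xs =
  subst (h ∷ q ++ x ∷ xs ⟿[_] x ∷ h ∷ (q ++ xs)) (+-comm (length q) 1)
        (cons h (⟿-front q x xs) then flip h x (q ++ xs))

-- Only requested elements cost transpositions: each passes the whole queue, whose length never
-- changes. Emitting `h` and queueing `x` leaves the list as it is.
⟿-run : (p : A → Bool) (q xs : List A) → q ++ xs ⟿[ ∑ (𝟙 ∘ p) xs * length q ] run p q xs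
⟿-run p [] xs rewrite *-zeroʳ (∑ (𝟙 ∘ p) xs) = stay
⟿-run p (h ∷ q) [] = subst (_⟿[ 0 ] h ∷ q) (sym (++-identityʳ (h ∷ q))) stay
⟿-run p (h ∷ q) (x ∷ xs) with p x
... | true  = ⟿-front (h ∷ q) x xs then cons x (⟿-run p (h ∷ q) xs)
... | false = cons h (absorb (⟿-run p (q ∷ʳ x) xs))
  where
  absorb : (q ∷ʳ x) ++ xs ⟿[ ∑ (𝟙 ∘ p) xs * length (q ∷ʳ x) ] run p (q ∷ʳ x) xs →
            q ++ x ∷ xs ⟿[ ∑ (𝟙 ∘ p) xs * suc (length q) ] run p (q ∷ʳ x) xs
  absorb s rewrite ++-assoc q (x ∷ []) xs | length-++ q {x ∷ []} | +-comm (length q) 1 = s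

-- Each requested element of `xs` jumps ahead of the queue once and so pushes any other element back
-- by at most one place.
pos-run-≤ : (p : Fin n → Bool) (q xs : List (Fin n)) (e : Fin n) →
            pos (run p q xs) e ≤ pos (q ++ xs) e + ∑ (𝟙 ∘ p) xs
pos-run-≤ p [] xs e = m≤m+n _ _
pos-run-≤ p (h ∷ q) [] e = 
  ≤-reflexive (trans (cong (λ ys → pos ys e) (sym (++-identityʳ (h ∷ q)))) (sym (+-identityʳ _)))
pos-run-≤ p (h ∷ q) (x ∷ xs) e with p x
... | false = pos-∷-mono h (run p (q ∷ʳ x) xs) (q ++ x ∷ xs) _ e (subst (λ ys → pos (run p (q ∷ʳ x) xs) e ≤ pos ys e + _)
                                      (++-assoc q (x ∷ []) xs) (pos-run-≤ p (q ∷ʳ x) xs e))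
... | true with x ≟ e
...   | yes refl = ≤-trans (s≤s z≤n) (m≤n+m _ (pos (h ∷ q ++ x ∷ xs) e))
...   | no  x≢e  = begin
  suc (pos (run p (h ∷ q) xs) e)                           ≤⟨ s≤s (pos-run-≤ p (h ∷ q) xs e) ⟩
  suc (pos (h ∷ q ++ xs) e + ∑ (𝟙 ∘ p) xs)                 ≡⟨ +-suc _ _ ⟨
  pos (h ∷ q ++ xs) e + suc (∑ (𝟙 ∘ p) xs)                 ≤⟨ +-monoˡ-≤ _ (pos-insert (h ∷ q) x≢e xs) ⟩
  pos (h ∷ q ++ x ∷ xs) e + suc (∑ (𝟙 ∘ p) xs)             ∎
  where open ≤-Reasoning

-- In q ++ xs the element e is at position length q + pos xs e, so it gains length q.
pos-run-requested : (p : Fin n → Bool) (q xs : List (Fin n)) {e : Fin n} → e ∈ xs → p e ≡ true →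
                    All (λ x → p x ≡ false) q → pos (run p q xs) e ≤ pos xs e
pos-run-requested p []      xs       e∈ pe qN = ≤-refl
pos-run-requested p (h ∷ q) (x ∷ xs) {e} e∈ pe (hN ∷ qN) with p x in px
pos-run-requested p (h ∷ q) (x ∷ xs) (here refl) pe (hN ∷ qN) | true
  rewrite pos-here x (run p (h ∷ q) xs) | pos-here x xs = ≤-refl
pos-run-requested p (h ∷ q) (x ∷ xs) {e} (there e∈) pe (hN ∷ qN) | true with x ≟ e
... | yes _ = ≤-refl
... | no  _ = s≤s (pos-run-requested p (h ∷ q) xs e∈ pe (hN ∷ qN))
pos-run-requested p (h ∷ q) (x ∷ xs) (here refl) pe (hN ∷ qN) | false = contradiction (trans (sym pe) px) λ ()
pos-run-requested p (h ∷ q) (x ∷ xs) {e} (there e∈) pe (hN ∷ qN) | false with x ≟ e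
... | yes refl = contradiction (trans (sym pe) px) λ ()
... | no  _    = ≤-trans (pos-∷-≤ h (run p (q ∷ʳ x) xs) e) (s≤s (pos-run-requested p (q ∷ʳ x) xs e∈ pe (All.∷ʳ⁺ qN px)))

-- The effect of one step of Move-All-Equally.

module _ (L S : List (Fin n)) where

  passed : List (Fin n)
  passed = takeWhileᵇ (λ x → not (x ∈ᵇ S)) L

  remaining : List (Fin n)
  remaining = dropWhileᵇ (λ x → not (x ∈ᵇ S)) L

  passed++remaining : passed ++ remaining ≡ L
  passed++remaining = takeWhile++dropWhile (T? ∘ λ x → not (x ∈ᵇ S)) L

  passed-unrequested : All (λ x → (x ∈ᵇ S) ≡ false) passed
  passed-unrequested =
    All.map (λ t → not-injective (Equivalence.to T-≡ t)) (All.all-takeWhile (T? ∘ λ x → not (x ∈ᵇ S)) L)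

  mae≡run : mae L S ≡ run (_∈ᵇ S) passed remaining
  mae≡run = fill-run (_∈ᵇ S) passed remaining

  hits : ℕ
  hits = ∑ (λ x → 𝟙 (x ∈ᵇ S)) remaining

  hits≤length : Unique L → hits ≤ length S
  hits≤length uL = begin
    hits                                                  ≤⟨ m≤n+m hits _ ⟩
    ∑ (λ x → 𝟙 (x ∈ᵇ S)) passed + hits                    ≡⟨ ∑-++ (λ x → 𝟙 (x ∈ᵇ S)) passed remaining ⟨
    ∑ (λ x → 𝟙 (x ∈ᵇ S)) (passed ++ remaining)            ≡⟨ cong (∑ (λ x → 𝟙 (x ∈ᵇ S))) passed++remaining ⟩
    ∑ (λ x → 𝟙 (x ∈ᵇ S)) L                                ≤⟨ ∑-∈ᵇ uL S ⟩
    length S                                              ∎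
    where open ≤-Reasoning

  mae-⟿ : L ⟿[ hits * length passed ] mae L S
  mae-⟿ rewrite mae≡run =
    subst (_⟿[ hits * length passed ] run (_∈ᵇ S) passed remaining) passed++remaining
          (⟿-run (_∈ᵇ S) passed remaining)

  mae-↭ : L ↭ mae L S
  mae-↭ = ⟿-↭ mae-⟿

  pos-mae-≤ : ∀ e → pos (mae L S) e ≤ pos L e + hits
  pos-mae-≤ e rewrite mae≡run =
    subst (λ M → pos (run (_∈ᵇ S) passed remaining) e ≤ pos M e + hits) passed++remaining
          (pos-run-≤ (_∈ᵇ S) passed remaining e)

  -- A requested element lies behind the passed prefix, so its position in `L` exceeds that in
  -- `remaining` by `length passed`, and the latter bounds its new position.
  pos-mae-requested : ∀ {e} → e ∈ L → (e ∈ᵇ S) ≡ true → pos (mae L S) e + length passed ≤ pos L e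
  pos-mae-requested {e} e∈L e∈S = begin
    pos (mae L S) e + length passed
      ≡⟨ cong (λ M → pos M e + length passed) mae≡run ⟩
    pos (run (_∈ᵇ S) passed remaining) e + length passed
      ≤⟨ +-monoˡ-≤ _ (pos-run-requested (_∈ᵇ S) passed remaining e∈remaining e∈S passed-unrequested) ⟩
    pos remaining e + length passed
      ≡⟨ +-comm (pos remaining e) _ ⟩
    length passed + pos remaining e
      ≡⟨ pos-skip passed≢e remaining ⟨
    pos (passed ++ remaining) e
      ≡⟨ cong (λ M → pos M e) passed++remaining ⟩
    pos L e ∎
    where
    open ≤-Reasoning
    passed≢e : All (_≢ e) passed
    passed≢e = All.map (λ { x∉S refl → contradiction (trans (sym e∈S) x∉S) λ () }) passed-unrequested
    e∈remaining : e ∈ remaining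
    e∈remaining with ∈-++⁻ passed (subst (e ∈_) (sym passed++remaining) e∈L)
    ... | inj₁ e∈passed    = contradiction refl (All.lookup passed≢e e∈passed)
    ... | inj₂ e∈remaining = e∈remaining

  dKT-mae : L ↭ allFin n → dKT L (mae L S) ≤ hits * length passed
  dKT-mae L↭ = ≤-trans
    (≤-reflexive (dKT≡inversions (perm-complete L↭) (perm-complete (↭-trans (↭-sym mae-↭) L↭))))
    (inversions-⟿ mae-⟿)

-- The amortised cost of one request.

potential : (Fin n → ℕ) → List (Fin n) → ℕ
potential {n} w L = ∑ (λ e → w e * pos L e) (allFin n)

module _ (g : Fin n → ℕ) (v : ℕ → ℕ) (v-antitone : ∀ {i j} → i ≤ j → v j ≤ v i)
         {L S : List (Fin n)} (L↭ : L ↭ allFin n) (t : Fin n) (t∈S : (t ∈ᵇ S) ≡ true) where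

  private
    i p r N : ℕ
    i = g t
    p = length (passed L S)
    r = length S
    N = ∑ (λ e → 𝟙 (g e ≤ᵇ i)) (allFin n)

    L′ : List (Fin n)
    L′ = mae L S

    δ : Fin n → ℕ
    δ e = pos L′ e ∸ pos L e

    hits≤r : hits L S ≤ r
    hits≤r = hits≤length L S (perm-unique L↭)

    -- The drop caused by `t`, written as a function of the element so that the comparison can be
    -- made term by term.
    gain : Fin n → ℕ
    gain e = if does (t ≟ e) then v i * p else 0

    -- Backward movement is bounded in two ways: in groups up to `i`, by `r` per element at the top
    -- weight `v 0`; in later groups, by the total drift at weight at most `v (suc i)`.
    potential-change : potential (v ∘ g) L′ + v i * p ≤
                     potential (v ∘ g) L + (N * (v 0 * r) + v (suc i) * (r * p))
  potential-change = begin
    potential (v ∘ g) L′ + v i * p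
      ≤⟨ +-monoʳ-≤ _ gain-t ⟩
    potential (v ∘ g) L′ + ∑ gain (allFin n)
      ≡⟨ ∑-+ _ gain (allFin n) ⟨
    ∑ (λ e → v (g e) * pos L′ e + gain e) (allFin n)
      ≤⟨ ∑-mono pointwise (allFin n) ⟩
    ∑ (λ e → v (g e) * pos L e + (𝟙 (g e ≤ᵇ i) * (v 0 * r) + v (suc i) * δ e)) (allFin n)
      ≡⟨ ∑-+ (λ e → v (g e) * pos L e) _ (allFin n) ⟩
    potential (v ∘ g) L + ∑ (λ e → 𝟙 (g e ≤ᵇ i) * (v 0 * r) + v (suc i) * δ e) (allFin n)
      ≡⟨ cong (potential (v ∘ g) L +_) (∑-+ (λ e → 𝟙 (g e ≤ᵇ i) * (v 0 * r)) (λ e → v (suc i) * δ e) (allFin n)) ⟩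
    potential (v ∘ g) L + (∑ (λ e → 𝟙 (g e ≤ᵇ i) * (v 0 * r)) (allFin n) + ∑ (λ e → v (suc i) * δ e) (allFin n))
      ≡⟨ cong (potential (v ∘ g) L +_) (cong₂ _+_ (∑-*ʳ (v 0 * r) (λ e → 𝟙 (g e ≤ᵇ i)) (allFin n))
                                                  (∑-*ˡ (v (suc i)) δ (allFin n))) ⟩
    potential (v ∘ g) L + (N * (v 0 * r) + v (suc i) * drift L L′)
      ≤⟨ +-monoʳ-≤ (potential (v ∘ g) L) (+-monoʳ-≤ (N * (v 0 * r)) (*-monoʳ-≤ (v (suc i))
           (≤-trans (drift-⟿ (mae-⟿ L S)) (*-monoˡ-≤ p hits≤r)))) ⟩
    potential (v ∘ g) L + (N * (v 0 * r) + v (suc i) * (r * p)) ∎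
    where
    open ≤-Reasoning
    gain-t : v i * p ≤ ∑ gain (allFin n)
    gain-t = ≤-trans (≤-reflexive (sym (cong (if_then v i * p else 0) (dec-true (t ≟ t) refl))))
                     (∑-term gain (∈-allFin t))
    loss : ∀ e → v (g e) * δ e ≤ 𝟙 (g e ≤ᵇ i) * (v 0 * r) + v (suc i) * δ e
    loss e with g e ≤ᵇ i in ge≤i
    ... | true  = ≤-trans (*-mono-≤ (v-antitone z≤n)
                             (m≤n+o⇒m∸n≤o _ (pos L e) (≤-trans (pos-mae-≤ L S e) (+-monoʳ-≤ (pos L e) hits≤r))))
                          (≤-trans (≤-reflexive (sym (*-identityˡ _))) (m≤m+n _ _))
    ... | false = *-monoˡ-≤ (δ e) (v-antitone (≰⇒> λ le → subst T ge≤i (≤⇒≤ᵇ le)))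
    pointwise : ∀ e → v (g e) * pos L′ e + gain e ≤
                      v (g e) * pos L e + (𝟙 (g e ≤ᵇ i) * (v 0 * r) + v (suc i) * δ e)
    pointwise e with t ≟ e
    ... | yes refl = ≤-trans (≤-reflexive (sym (*-distribˡ-+ (v i) (pos L′ t) p)))
                    (≤-trans (*-monoʳ-≤ (v i) (pos-mae-requested L S (perm-complete L↭ t) t∈S)) (m≤m+n _ _))
    ... | no _ = begin
      v (g e) * pos L′ e + 0                     ≡⟨ +-identityʳ _ ⟩
      v (g e) * pos L′ e                         ≤⟨ *-monoʳ-≤ (v (g e)) (m≤n+m∸n (pos L′ e) (pos L e)) ⟩
      v (g e) * (pos L e + δ e)                  ≡⟨ *-distribˡ-+ (v (g e)) (pos L e) (δ e) ⟩
      v (g e) * pos L e + v (g e) * δ e          ≤⟨ +-monoʳ-≤ _ (loss e) ⟩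
      v (g e) * pos L e + (𝟙 (g e ≤ᵇ i) * (v 0 * r) + v (suc i) * δ e) ∎

  -- The terms proportional to `p` come from the request, the transpositions and the later groups.
  -- Together they are at most `suc r * v (suc i) * p`, which the drop `v i * p` covers.
  amortised-cost : suc r ≤ v (suc i) → suc r * v (suc i) ≤ v i →
                   reqCost L S + dKT L L′ + potential (v ∘ g) L′ ≤
                   suc (N * (v 0 * r)) + potential (v ∘ g) L
  amortised-cost r<v₁ v₁≪vᵢ = +-cancelʳ-≤ (v i * p) _ _ (begin
    reqCost L S + dKT L L′ + potential (v ∘ g) L′ + v i * p
      ≡⟨ +-assoc (reqCost L S + dKT L L′) _ _ ⟩
    reqCost L S + dKT L L′ + (potential (v ∘ g) L′ + v i * p)
      ≤⟨ +-mono-≤ (+-mono-≤ (reqCost-≤-prefix L S) (≤-trans (dKT-mae L S L↭) (*-monoˡ-≤ p hits≤r)))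
                  potential-change ⟩
    suc p + r * p + (potential (v ∘ g) L + (N * (v 0 * r) + v (suc i) * (r * p)))
      ≡⟨ regroup p r (potential (v ∘ g) L) (N * (v 0 * r)) (v (suc i)) ⟩
    suc (N * (v 0 * r)) + potential (v ∘ g) L + (suc r + v (suc i) * r) * p
      ≤⟨ +-monoʳ-≤ (suc (N * (v 0 * r)) + potential (v ∘ g) L) (*-monoˡ-≤ p (begin
           suc r + v (suc i) * r        ≤⟨ +-mono-≤ r<v₁ (≤-reflexive (*-comm (v (suc i)) r)) ⟩
           suc r * v (suc i)            ≤⟨ v₁≪vᵢ ⟩
           v i                          ∎)) ⟩
    suc (N * (v 0 * r)) + potential (v ∘ g) L + v i * p ∎)
    where
    open ≤-Reasoning
    regroup : ∀ p r Φ a v₁ → suc p + r * p + (Φ + (a + v₁ * (r * p))) ≡ suc a + Φ + (suc r + v₁ * r) * p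
    regroup = solve-∀

-- Logarithms and rounded-up square roots.

2^⌊log₂n⌋≤n : ∀ n → 1 ≤ n → 2 ^ ⌊log₂ n ⌋ ≤ n
2^⌊log₂n⌋≤n = <-rec _ step
  where
  step : ∀ n → (∀ {m} → m < n → 1 ≤ m → 2 ^ ⌊log₂ m ⌋ ≤ m) → 1 ≤ n → 2 ^ ⌊log₂ n ⌋ ≤ n
  step 1 rec _ = ≤-refl
  step n@(suc (suc k)) rec _ = begin
    -- Here `n` is at least 2, so its logarithm is positive and the subtraction is not truncated.
    2 ^ ⌊log₂ n ⌋                       ≡⟨ cong (2 ^_) (m+[n∸m]≡n (⌊log₂⌋-mono-≤ {2} {n} (s≤s (s≤s z≤n)))) ⟨
    2 * 2 ^ (⌊log₂ n ⌋ ∸ 1)             ≡⟨ cong (λ m → 2 * 2 ^ m) (⌊log₂⌊n/2⌋⌋≡⌊log₂n⌋∸1 n) ⟨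
    2 * 2 ^ ⌊log₂ ⌊ n /2⌋ ⌋             ≤⟨ *-monoʳ-≤ 2 (rec (⌊n/2⌋<n (suc k)) (s≤s z≤n)) ⟩
    2 * ⌊ n /2⌋                         ≡⟨ cong (⌊ n /2⌋ +_) (+-identityʳ _) ⟩
    ⌊ n /2⌋ + ⌊ n /2⌋                   ≤⟨ +-monoʳ-≤ ⌊ n /2⌋ (⌊n/2⌋≤⌈n/2⌉ n) ⟩
    ⌊ n /2⌋ + _                         ≡⟨ ⌊n/2⌋+⌈n/2⌉≡n n ⟩
    n                                   ∎
    where open ≤-Reasoning

n<2^m : ∀ {n m} → ⌊log₂ n ⌋ < m → n < 2 ^ m
n<2^m {n} {m} log<m = ≰⇒> λ 2^m≤n →
  <⇒≱ log<m (≤-trans (≤-reflexive (sym (⌊log₂[2^n]⌋≡n m))) (⌊log₂⌋-mono-≤ 2^m≤n))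

-- The unification in csqrt-unfold identifies csqrtFrom with the helper local to csqrt,
-- which has no accessible name.
mutual
  csqrtFrom : ℕ → ℕ → ℕ → ℕ
  csqrtFrom = _

  csqrt-unfold : ∀ m → csqrt (suc m) ≡ csqrtFrom (suc m) 1 m
  csqrt-unfold m with suc m | 1
  ... | w | k = refl

-- The sum `k + fuel` is invariant, so if the fuel runs out, the last candidate satisfies the bound
-- by hypothesis.
csqrtFrom-upper : ∀ m k fuel → m ≤ (k + fuel) * (k + fuel) →
                  m ≤ csqrtFrom m k fuel * csqrtFrom m k fuel
csqrtFrom-upper m k zero m≤ rewrite +-identityʳ k = m≤
csqrtFrom-upper m k (suc fuel) m≤ with m ≤ᵇ k * k in k-suffices
... | true  = ≤ᵇ⇒≤ m (k * k) (subst T (sym k-suffices) _)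
... | false = csqrtFrom-upper m (suc k) fuel (subst (λ x → m ≤ x * x) (+-suc k fuel) m≤)

m≤csqrt² : ∀ m → m ≤ csqrt m * csqrt m
m≤csqrt² zero    = z≤n
m≤csqrt² (suc m) rewrite csqrt-unfold m = csqrtFrom-upper (suc m) 1 m (m≤m*n (suc m) (suc m))

-- Grouping by static position.

module _ (n r s R : ℕ) .{{_ : NonZero s}} (1≤r : 1 ≤ r) (r<R : suc r ≤ R) where

  private
    K : ℕ
    -- Group numbers are at most `⌊log₂ n ⌋ / s`. The extra 2 keeps the exponent of `v (suc (g t))`
    -- positive, so that this weight is at least `R`.
    K = 2 + ⌊log₂ n ⌋ / s

    v : ℕ → ℕ
    v i = R ^ (K ∸ i)

    instance
      R≢0 : NonZero R
      R≢0 = >-nonZero (≤-trans (s≤s z≤n) r<R)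

    v-antitone : ∀ {i j} → i ≤ j → v j ≤ v i
    v-antitone i≤j = ^-monoʳ-≤ R (∸-monoʳ-≤ K i≤j)

    c : ℕ
    c = suc (2 ^ s * (R ^ K * r))

    module _ {π : List (Fin n)} (π↭ : π ↭ allFin n) where

      g : Fin n → ℕ
      g e = ⌊log₂ pos π e ⌋ / s

      pos≤n : {L : List (Fin n)} → L ↭ allFin n → ∀ e → pos L e ≤ n
      pos≤n {L} L↭ e = ≤-trans (pos≤length L e) (≤-reflexive (trans (↭-length L↭) (length-tabulate {n = n} _)))

      g≤ : ∀ e → g e ≤ ⌊log₂ n ⌋ / s
      g≤ e = /-monoˡ-≤ s (⌊log₂⌋-mono-≤ (pos≤n π↭ e))

      -- If `e` is in a group up to that of `t`, the logarithm of its position is below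
      -- `s + g t * s`, hence its position is at most `2 ^ s` times that of `t`. At most that many
      -- elements have such positions.
      group-count : ∀ t → ∑ (λ e → 𝟙 (g e ≤ᵇ g t)) (allFin n) ≤ 2 ^ s * pos π t
      group-count t = begin
        ∑ (λ e → 𝟙 (g e ≤ᵇ g t)) (allFin n)                  ≤⟨ ∑-mono pointwise (allFin n) ⟩
        -- Reordering the sum along `π` brings it into the form of `count-pos≤`.
        ∑ (λ e → 𝟙 (pos π e ≤ᵇ 2 ^ s * pos π t)) (allFin n)  ≡⟨ sum-↭ (map⁺ _ π↭) ⟨
        ∑ (λ e → 𝟙 (pos π e ≤ᵇ 2 ^ s * pos π t)) π           ≤⟨ count-pos≤ (perm-unique π↭) _ ⟩
        2 ^ s * pos π t ∎
        where
        open ≤-Reasoning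
        early : ∀ e → g e ≤ g t → pos π e ≤ 2 ^ s * pos π t
        early e ge≤gt = begin
          pos π e                     ≤⟨ <⇒≤ (n<2^m {m = s + g t * s} log<) ⟩
          2 ^ (s + g t * s)           ≡⟨ ^-distribˡ-+-* 2 s (g t * s) ⟩
          2 ^ s * 2 ^ (g t * s)       ≤⟨ *-monoʳ-≤ (2 ^ s) (^-monoʳ-≤ 2 (m/n*n≤m ⌊log₂ pos π t ⌋ s)) ⟩
          2 ^ s * 2 ^ ⌊log₂ pos π t ⌋ ≤⟨ *-monoʳ-≤ (2 ^ s) (2^⌊log₂n⌋≤n _ (pos≥1 (perm-complete π↭ t))) ⟩
          2 ^ s * pos π t             ∎
          where
          log< : ⌊log₂ pos π e ⌋ < s + g t * s
          log< = begin-strict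
            ⌊log₂ pos π e ⌋                       ≡⟨ m≡m%n+[m/n]*n ⌊log₂ pos π e ⌋ s ⟩
            ⌊log₂ pos π e ⌋ % s + g e * s         <⟨ +-mono-<-≤ (m%n<n ⌊log₂ pos π e ⌋ s) (*-monoˡ-≤ s ge≤gt) ⟩
            s + g t * s                           ∎
        pointwise : ∀ e → 𝟙 (g e ≤ᵇ g t) ≤ 𝟙 (pos π e ≤ᵇ 2 ^ s * pos π t)
        pointwise e with g e ≤ᵇ g t in ge≤gt
        ... | false = z≤n
        ... | true rewrite Equivalence.to T-≡ (≤⇒≤ᵇ (early e (≤ᵇ⇒≤ _ _ (subst T (sym ge≤gt) _)))) = ≤-refl

      Φ : List (Fin n) → ℕ
      Φ = potential (v ∘ g)

      request-cost : {L S : List (Fin n)} → L ↭ allFin n → length S ≡ r →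
                     reqCost L S + dKT L (mae L S) + Φ (mae L S) ≤ c * reqCost π S + Φ L
      request-cost {S = []} _ refl = contradiction 1≤r λ ()
      request-cost {L} {s₀ ∷ S} L↭ refl with reqCost-attained π s₀ S
      ... | t , t∈S , t≤ = ≤-trans
        (amortised-cost g v v-antitone {L} {s₀ ∷ S} L↭ t t∈S r<v₁ v₁≪vᵢ)
        (+-monoˡ-≤ (Φ L) (begin
          suc (N * X)                   ≤⟨ s≤s (*-monoˡ-≤ X (group-count t)) ⟩
          -- Positions start at 1, so the additive 1 is charged to `pos π t`.
          suc (2 ^ s * pos π t * X)     ≤⟨ +-monoˡ-≤ _ (pos≥1 (perm-complete π↭ t)) ⟩
          pos π t + 2 ^ s * pos π t * X ≡⟨ factor (pos π t) (2 ^ s) X ⟩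
          c * pos π t                   ≤⟨ *-monoʳ-≤ c t≤ ⟩
          c * reqCost π (s₀ ∷ S)        ∎))
        where
        open ≤-Reasoning
        N X : ℕ
        N = ∑ (λ e → 𝟙 (g e ≤ᵇ g t)) (allFin n)
        X = R ^ K * r
        factor : ∀ j b x → j + b * j * x ≡ suc (b * x) * j
        factor = solve-∀
        r<v₁ : suc r ≤ v (suc (g t))
        r<v₁ rewrite +-∸-assoc 1 (g≤ t) = ≤-trans r<R (m≤m*n R _ {{m^n≢0 R (⌊log₂ n ⌋ / s ∸ g t)}})
        -- No truncation occurs in the exponents, so consecutive weights differ by the factor `R`
        -- exactly.
        v₁≪vᵢ : suc r * v (suc (g t)) ≤ v (g t)
        v₁≪vᵢ rewrite +-∸-assoc 1 (g≤ t) | +-∸-assoc 2 (g≤ t) = *-monoˡ-≤ _ r<R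

      -- The potentials telescope; the initial one remains as the additive term.
      total-cost : {L : List (Fin n)} → L ↭ allFin n → {Ss : List (List (Fin n))} →
                   All (λ S → length S ≡ r) Ss → maeCost L Ss ≤ c * staticCost π Ss + Φ L
      total-cost _ [] = z≤n
      total-cost {L} L↭ {S ∷ Ss} (lenS ∷ lens) = begin
        k + maeCost L′ Ss                                    ≤⟨ +-monoʳ-≤ k (total-cost L′↭ lens) ⟩
        k + (c * staticCost π Ss + Φ L′)                     ≡⟨ rotate k (c * staticCost π Ss) (Φ L′) ⟩
        k + Φ L′ + c * staticCost π Ss                       ≤⟨ +-monoˡ-≤ _ (request-cost {L} {S} L↭ lenS) ⟩
        c * reqCost π S + Φ L + c * staticCost π Ss          ≡⟨ collect c (reqCost π S) (Φ L) (staticCost π Ss) ⟩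
        c * (reqCost π S + staticCost π Ss) + Φ L            ∎
        where
        open ≤-Reasoning
        L′ = mae L S
        k  = reqCost L S + dKT L L′
        L′↭ : L′ ↭ allFin n
        L′↭ = ↭-trans (↭-sym (mae-↭ L S)) L↭
        rotate : ∀ a b c → a + (b + c) ≡ a + c + b
        rotate = solve-∀
        collect : ∀ c x Φ y → c * x + Φ + c * y ≡ c * (x + y) + Φ
        collect = solve-∀

  -- The initial potential is bounded uniformly: every weight is at most `v 0` and every position at
  -- most `n`.
  mae-competitive : {L : List (Fin n)} → L ↭ allFin n → {Ss : List (List (Fin n))} →
                    All (λ S → length S ≡ r) Ss → {π : List (Fin n)} → π ↭ allFin n →
                    maeCost L Ss ≤ suc (2 ^ s * (R ^ (2 + ⌊log₂ n ⌋ / s) * r)) * staticCost π Ss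
                                   + length (allFin n) * (R ^ (2 + ⌊log₂ n ⌋ / s) * n)
  mae-competitive L↭ lens π↭ = ≤-trans (total-cost π↭ L↭ lens) (+-monoʳ-≤ _
    (∑-≤-length _ _ (λ e → *-mono-≤ (v-antitone {0} {g π↭ e} z≤n) (pos≤n π↭ L↭ e)) (allFin n)))

-- The choice of the parameters.

1≤⌊log₂n⌋ : ∀ {n} → 2 ≤ n → 1 ≤ ⌊log₂ n ⌋
1≤⌊log₂n⌋ = ⌊log₂⌋-mono-≤

1≤csqrt : ∀ {n r} → 2 ≤ n → 2 ≤ r → 1 ≤ csqrt (⌊log₂ n ⌋ * ⌊log₂ r ⌋)
1≤csqrt {n} {r} 2≤n 2≤r = n≢0⇒n>0 λ s≡0 →
  contradiction (≤-trans (*-mono-≤ (1≤⌊log₂n⌋ 2≤n) (1≤⌊log₂n⌋ 2≤r))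
                         (≤-trans (m≤csqrt² (⌊log₂ n ⌋ * ⌊log₂ r ⌋)) (≤-reflexive (cong₂ _*_ s≡0 s≡0))))
                λ ()

-- This justifies the choice of `R` as a power of two above `r`: since log r is at least 1, doubling
-- it makes room for the rounding.
r<2^2log : ∀ {r} → 2 ≤ r → suc r ≤ 2 ^ (2 * ⌊log₂ r ⌋)
r<2^2log {r} 2≤r = n<2^m {r} {2 * ⌊log₂ r ⌋}
  (≤-trans (+-monoˡ-≤ ⌊log₂ r ⌋ (1≤⌊log₂n⌋ 2≤r)) (≤-reflexive (cong (⌊log₂ r ⌋ +_) (sym (+-identityʳ _)))))

m²≤n²⇒m≤n : ∀ {m n} → m * m ≤ n * n → m ≤ n
m²≤n²⇒m≤n m²≤n² = ≮⇒≥ λ n<m → <⇒≱ (*-mono-< n<m n<m) m²≤n²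

-- The choice s = ⌈√(a ℓ)⌉ balances the group size 2^s against the weight ratio 2^O(ℓ a / s).
exponent-bound : ∀ a ℓ s .{{_ : NonZero s}} → ℓ ≤ a → a * ℓ ≤ s * s →
                 suc (s + (2 * ℓ * (2 + a / s) + 2 * ℓ)) ≤ 10 * s
exponent-bound a ℓ s ℓ≤a aℓ≤s² = begin
  suc (s + (2 * ℓ * (2 + a / s) + 2 * ℓ))     ≡⟨ expand s ℓ (a / s) ⟩
  1 + s + 6 * ℓ + 2 * (ℓ * (a / s))           ≤⟨ +-mono-≤ (+-mono-≤ (+-monoˡ-≤ s (>-nonZero⁻¹ s)) (*-monoʳ-≤ 6 ℓ≤s))
                                                          (*-monoʳ-≤ 2 ℓq≤s) ⟩
  s + s + 6 * s + 2 * s                       ≡⟨ collect s ⟩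
  10 * s                                      ∎
  where
  open ≤-Reasoning
  expand : ∀ s ℓ q → suc (s + (2 * ℓ * (2 + q) + 2 * ℓ)) ≡ 1 + s + 6 * ℓ + 2 * (ℓ * q)
  expand = solve-∀
  collect : ∀ s → s + s + 6 * s + 2 * s ≡ 10 * s
  collect = solve-∀
  ℓ≤s : ℓ ≤ s
  ℓ≤s = m²≤n²⇒m≤n (≤-trans (*-monoˡ-≤ ℓ ℓ≤a) aℓ≤s²)
  ℓq≤s : ℓ * (a / s) ≤ s
  ℓq≤s = *-cancelʳ-≤ (ℓ * (a / s)) s s (begin
    ℓ * (a / s) * s       ≡⟨ *-assoc ℓ (a / s) s ⟩
    ℓ * (a / s * s)       ≤⟨ *-monoʳ-≤ ℓ (m/n*n≤m a s) ⟩
    ℓ * a                 ≡⟨ *-comm ℓ a ⟩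
    a * ℓ                 ≤⟨ aℓ≤s² ⟩
    s * s                 ∎)

-- All factors become powers of two, with `r` rounded up to `R`; the leading `suc` costs at most one
-- doubling.
constant≤ratio : ∀ n r .{{_ : NonZero (csqrt (⌊log₂ n ⌋ * ⌊log₂ r ⌋))}} → 2 ≤ r → r ≤ n →
                 suc (2 ^ csqrt (⌊log₂ n ⌋ * ⌊log₂ r ⌋) *
                      ((2 ^ (2 * ⌊log₂ r ⌋)) ^ (2 + ⌊log₂ n ⌋ / csqrt (⌊log₂ n ⌋ * ⌊log₂ r ⌋)) * r))
                 ≤ ratio 10 n r
constant≤ratio n r 2≤r r≤n = begin
  suc (2 ^ s * (R ^ K * r))                ≤⟨ s≤s (*-monoʳ-≤ (2 ^ s) (*-monoʳ-≤ (R ^ K) (<⇒≤ (r<2^2log 2≤r)))) ⟩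
  suc (2 ^ s * (R ^ K * R))                ≡⟨ cong (λ x → suc (2 ^ s * (x * R))) (^-*-assoc 2 (2 * ℓ) K) ⟩
  suc (2 ^ s * (2 ^ (2 * ℓ * K) * R))      ≡⟨ cong (λ x → suc (2 ^ s * x)) (^-distribˡ-+-* 2 (2 * ℓ * K) (2 * ℓ)) ⟨
  suc (2 ^ s * 2 ^ (2 * ℓ * K + 2 * ℓ))    ≡⟨ cong suc (^-distribˡ-+-* 2 s (2 * ℓ * K + 2 * ℓ)) ⟨
  suc (2 ^ E)                              ≤⟨ +-mono-≤ (m^n>0 2 E) (≤-reflexive (sym (+-identityʳ (2 ^ E)))) ⟩
  2 ^ suc E                                ≤⟨ ^-monoʳ-≤ 2 (exponent-bound ⌊log₂ n ⌋ ℓ s (⌊log₂⌋-mono-≤ r≤n) (m≤csqrt² _)) ⟩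
  2 ^ (10 * s)                             ∎
  where
  open ≤-Reasoning
  ℓ = ⌊log₂ r ⌋
  s = csqrt (⌊log₂ n ⌋ * ⌊log₂ r ⌋)
  R = 2 ^ (2 * ℓ)
  K = 2 + ⌊log₂ n ⌋ / s
  E = s + (2 * ℓ * K + 2 * ℓ)

theorem7 : ∃[ C ] ∀ (n r : ℕ) → 2 ≤ n → 2 ≤ r → ∃[ α ]
    ∀ (π₀ : List (Fin n)) → π₀ ↭ allFin n →
    ∀ (Ss : List (List (Fin n))) → All (λ S → Unique S × length S ≡ r) Ss →
    ∀ (π : List (Fin n)) → π ↭ allFin n →
    maeCost π₀ Ss ≤ ratio C n r * staticCost π Ss + α
-- The constant 10 comes from `exponent-bound`.
theorem7 = 10 , λ n r 2≤n 2≤r →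
  let instance s≢0 = >-nonZero (1≤csqrt 2≤n 2≤r) in
  -- The additive term is the bound on the initial potential in `mae-competitive`; it depends on `n`
  -- and `r` only.
  length (allFin n) * ((2 ^ (2 * ⌊log₂ r ⌋)) ^ (2 + ⌊log₂ n ⌋ / csqrt (⌊log₂ n ⌋ * ⌊log₂ r ⌋)) * n) , λ where
    -- The empty sequence is separate because `r ≤ n` is read off from the first request, which
    -- consists of `r` distinct elements.
    π₀ π₀↭ [] _ π π↭ → z≤n
    π₀ π₀↭ (S ∷ Ss) valid@((uS , refl) ∷ _) π π↭ → ≤-trans
      (mae-competitive n r (csqrt (⌊log₂ n ⌋ * ⌊log₂ r ⌋)) (2 ^ (2 * ⌊log₂ r ⌋))
        (<⇒≤ 2≤r) (r<2^2log 2≤r) π₀↭ (All.map proj₂ valid) π↭)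
      (+-monoˡ-≤ _ (*-monoˡ-≤ (staticCost π (S ∷ Ss)) (constant≤ratio n r 2≤r (unique-length uS))))
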